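{- The random partial order $\mathcal{U}=(U,\le)$ has no automatic presentation.
   Context: The random partial order is the Fraïssé limit of the class of all finite partially ordered sets, i.e. the unique up to isomorphism countable partial order that is ultra-homogeneous (every isomorphism between finite substructures extends to an automorphism) and whose finite substructures are, up to isomorphism, exactly all finite partial orders. For $\diamond\notin\Sigma$, the convolution $\otimes(w_1,\dots,w_n)$ of a tuple of words over a finite alphabet $\Sigma$ is the word of length $\max_i|w_i|$ over $(\Sigma\cup\{\diamond\})^n$ whose $k$-th symbol is $(\sigma_1,\dots,\sigma_n)$, where $\sigma_i$ is the $k$-th symbol of $w_i$ if $k\le|w_i|$ and $\sigma_i=\diamond$ otherwise. A relation $R\subseteq(\Sigma^\star)^n$ is FA recognisable if $\{\otimes w: w\in R\}$ is a regular language. A structure has an automatic presentation if it is isomorphic to a structure whose domain is a regular subset of $\Sigma^\star$ for some finite alphabet $\Sigma$ and whose atomic relations are FA recognisable. -}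

module Defs where

open import Data.Fin.Base using (Fin; toℕ)
open import Data.Fin.Subset using (Subset; _∈_)
open import Data.List.Base using (List; applyUpTo; drop; foldl; head; length)
open import Data.Maybe.Base using (Maybe)
open import Data.Nat.Base using (ℕ; _⊔_)
open import Data.Product.Base using (Σ-syntax; ∃; ∃-syntax; _×_; proj₁; proj₂)
open import Data.Vec.Base using (Vec; []; _∷_; foldr′; map)
open import Function.Base using (_on_)
open import Function.Bundles using (_⇔_; Surjection)
open import Level using (Level; 0ℓ) renaming (_⊔_ to _⊔ˡ_)
open import Relation.Binary.Bundles using (Poset)
open import Relation.Binary.Bundles.Raw using (RawRelation)
open import Relation.Binary.Core using (Rel)
import Relation.Binary.Construct.On as On
open import Relation.Binary.Morphism.Structures using (IsOrderIsomorphism)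
open import Relation.Binary.PropositionalEquality.Core using (_≡_)
open import Relation.Binary.PropositionalEquality.Properties using (setoid)
open import Relation.Binary.Structures using (IsDecPartialOrder)
open import Relation.Unary using (Pred)

private
  variable
    a c ℓ ℓ₁ ℓ₂ c′ ℓ₁′ ℓ₂′ : Level

------------------------------------------------------------------------
-- Regular languages and FA recognisable relations

record DFA (A : Set a) : Set a where
  field
    states : ℕ
    start  : Fin states
    step   : Fin states → A → Fin states
    final  : Subset states

  Accepts : Pred (List A) 0ℓ
  Accepts w = foldl step start w ∈ final

Regular : {A : Set a} → Pred (List A) ℓ → Set (a ⊔ˡ ℓ)
Regular {A = A} L = Σ[ M ∈ DFA A ] (∀ w → L w ⇔ DFA.Accepts M w)

-- Maybe A is A ∪ {⋄}, with nothing as ⋄.  Positions count from 0, and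
-- head (drop k w) is nothing exactly when k ≥ length w.
⊗ : {A : Set a} {n : ℕ} → Vec (List A) n → List (Vec (Maybe A) n)
⊗ ws = applyUpTo (λ k → map (λ w → head (drop k w)) ws)
                 (foldr′ _⊔_ 0 (map length ws))

FARecognisable : {A : Set a} {n : ℕ} → Pred (Vec (List A) n) ℓ → Set (a ⊔ˡ ℓ)
FARecognisable R = Regular (λ v → ∃[ ws ] (R ws × v ≡ ⊗ ws))

------------------------------------------------------------------------
-- Structures with one binary relation.  The equality _≈_ of a
-- RawRelation plays the role of identity of elements, so isomorphisms
-- are bijections up to it.

_≅_ : RawRelation c ℓ₁ ℓ₂ → RawRelation c′ ℓ₁′ ℓ₂′ → Set _
S ≅ T = ∃ (IsOrderIsomorphism S._≈_ T._≈_ S._∼_ T._∼_)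
  where
  module S = RawRelation S
  module T = RawRelation T

-- The equality compares words only: it ignores the proofs that they lie
-- in the domain.
wordStructure : {A : Set} → Pred (List A) 0ℓ → Pred (Vec (List A) 2) 0ℓ →
                RawRelation 0ℓ 0ℓ 0ℓ
wordStructure D R = record
  { Carrier = ∃ D
  ; _≈_     = _≡_ on proj₁
  ; _∼_     = (λ u v → R (u ∷ v ∷ [])) on proj₁
  }

-- Finite alphabets are taken to be Fin k.
record AutomaticPresentation (S : RawRelation c ℓ₁ ℓ₂) :
                             Set (Level.suc 0ℓ ⊔ˡ c ⊔ˡ ℓ₁ ⊔ˡ ℓ₂) where
  field
    k              : ℕ
    D              : Pred (List (Fin k)) 0ℓ
    R              : Pred (Vec (List (Fin k)) 2) 0ℓ
    R⊆D×D          : ∀ {u v} → R (u ∷ v ∷ []) → D u × D v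
    D-regular      : Regular D
    R-recognisable : FARecognisable R
    isomorphism    : wordStructure D R ≅ S

------------------------------------------------------------------------
-- The random partial order

-- Decidability is automatic classically.  Without it, embedding every
-- finite poset into one with decidable order would amount to excluded
-- middle.
record FinitePoset : Set₁ where
  field
    size              : ℕ
    _≤_               : Rel (Fin size) 0ℓ
    isDecPartialOrder : IsDecPartialOrder _≡_ _≤_

  rawRelation : RawRelation 0ℓ 0ℓ 0ℓ
  rawRelation = record { _≈_ = _≡_ ; _∼_ = _≤_ }

-- The substructure of U on the finite set {x 0, …, x (n - 1)}, carried
-- by indices.  Repetitions are allowed: i and j are identified when
-- x i ≈ x j.
substructure : (U : Poset c ℓ₁ ℓ₂) {n : ℕ} → (Fin n → Poset.Carrier U) →
               RawRelation 0ℓ ℓ₁ ℓ₂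
substructure U x = Poset.rawRelation (On.poset U x)

record IsRandomPartialOrder (U : Poset c ℓ₁ ℓ₂) :
                            Set (Level.suc 0ℓ ⊔ˡ c ⊔ˡ ℓ₁ ⊔ˡ ℓ₂) where
  open Poset U
  field
    countable : Surjection (setoid ℕ) Eq.setoid

    ultrahomogeneous :
      ∀ {m n} (x : Fin m → Carrier) (y : Fin n → Carrier)
      (φ : substructure U x ≅ substructure U y) →
      Σ[ σ ∈ rawRelation ≅ rawRelation ]
        (∀ i → proj₁ σ (x i) ≈ y (proj₁ φ i))

    substructures-finitePosets :
      ∀ {n} (x : Fin n → Carrier) →
      Σ[ P ∈ FinitePoset ] (substructure U x ≅ FinitePoset.rawRelation P)

    finitePosets-substructures :
      ∀ (P : FinitePoset) →
      ∃[ n ] Σ[ x ∈ (Fin n → Carrier) ]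
        (substructure U x ≅ FinitePoset.rawRelation P)

{-# OPTIONS --safe #-}
module Submission where

-- Let A be the set of the N words of length ≤ n in the domain of an automatic presentation.
-- For u ∈ A, acceptance of ⊗ (u , v) depends only on the prefix of v of length n, for which
-- there are O(N) possibilities, and on the set of states from which the rest of v is accepted.
-- So only O(N) order types over A are realised.  In the random partial order every pair
-- {i, j} ⊆ A determines a realised type: for i < j, that of a point whose lower set in A is ↓i
-- and whose upper set is ↑j; for incomparable i and j, that of a point with lower set ↓i ∪ ↓j
-- and no element of A above it.  The pair can be read off this type, so at least
-- N (N − 1) / 2 types are realised, a contradiction when N is large.

open import Defs
open import Data.Bool.Base using (Bool; true; false)
open import Data.Empty using (⊥; ⊥-elim)
open import Data.Fin.Base as Fin using
  (Fin; zero; suc; combine; remQuot; funToFin; finToFun; _↑ˡ_; _↑ʳ_; splitAt)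
open import Data.Fin.Properties as Fin using
  ( combine-injective; combine-remQuot; finToFun-funToFin; injective⇒≤
  ; splitAt-↑ˡ; splitAt-↑ʳ; ↑ˡ-injective; ↑ʳ-injective)
open import Data.Fin.Subset using () renaming (_∈_ to _∈ˢ_)
open import Data.Fin.Subset.Properties using (_∈?_)
open import Data.List.Base using
  ( List; []; _∷_; _++_; alignWith; allFin; applyUpTo; cartesianProductWith; drop
  ; filter; foldl; head; length; lookup; map; mapMaybe; take)
open import Data.List.Membership.Propositional using (_∈_)
open import Data.List.Membership.Propositional.Properties using
  (∈-allFin; ∈-cartesianProductWith⁺; ∈-cartesianProductWith⁻; ∈-filter⁺; ∈-filter⁻; ∈-lookup)
open import Data.List.Properties using
  ( ++-cancelʳ; ++-identityʳ; ∷-injective; foldl-++; length-++; length-take; map-++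
  ; take++drop≡id)
open import Data.List.Relation.Unary.All as All using ([]; _∷_)
open import Data.List.Relation.Unary.AllPairs using ([]; _∷_)
open import Data.List.Relation.Unary.Any using (here; there; index)
open import Data.List.Relation.Unary.Any.Properties using (lookup-index)
open import Data.List.Relation.Unary.Unique.Propositional using (Unique)
open import Data.List.Relation.Unary.Unique.Propositional.Properties using
  (allFin⁺; cartesianProductWith⁺; filter⁺)
open import Data.Maybe.Base using (Maybe)
open import Data.Nat.Base as ℕ using (ℕ; zero; suc; _+_; _*_; _^_; _⊔_; z≤n; s≤s)
open import Data.Nat.Properties as ℕ using
  ( ≤-reflexive; ≤-trans; +-mono-≤; m≤m⊔n; m≤n⊔m; m⊓n≤m; m≤m+n; ⊔-identityʳ
  ; m≤n⇒∃[o]m+o≡n; module ≤-Reasoning)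
open import Data.Nat.Solver using (module +-*-Solver)
open import Data.Product.Base as Product using
  (Σ-syntax; ∃; ∃-syntax; _×_; _,_; proj₁; proj₂; uncurry)
open import Data.Sum.Base as Sum using (_⊎_; inj₁; inj₂)
open import Data.These using (These; this; that; fromThis; fromThat; swap)
open import Data.Unit.Base using (⊤; tt)
open import Data.Vec.Base as Vec using (Vec; []; _∷_)
open import Effect.Monad using (RawMonad)
open import Function.Base using (_∘_; id)
open import Function.Bundles using (_⇔_; mk⇔; Equivalence)
open import Function.Construct.Composition using (_⇔-∘_)
open import Function.Construct.Symmetry using (⇔-sym)
open import Function.Definitions using (Injective)
open import Level using (Level; 0ℓ)
open import Relation.Binary.Bundles using (Poset)
open import Relation.Binary.Core using (Rel)
open import Relation.Binary.Morphism.Structures using (IsOrderIsomorphism)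
open import Relation.Binary.PropositionalEquality.Core
open import Relation.Binary.PropositionalEquality.Properties using
  (isEquivalence; module ≡-Reasoning)
open import Relation.Binary.Structures using (IsDecPartialOrder; module IsDecTotalOrder)
open import Relation.Nullary using (¬_; Dec; yes; no; contradiction)
open import Relation.Nullary.Decidable using (_⊎-dec_; map′; does)
open import Relation.Nullary.Negation using (¬¬-Monad; ¬¬-map)
open import Relation.Unary using (Pred; Decidable; _≐_; _⊆_; ∅)
open import Relation.Unary.Properties using (≐-refl; ≐-trans)

open Equivalence using (to; from)

private
  variable
    a c p q ℓ₁ ℓ₂ : Level
    A : Set a
    B C : Set a

-- Convolutions of two words

pair : These A A → Vec (Maybe A) 2
pair t = fromThis t ∷ fromThat t ∷ []

applyUpTo-cong : {f g : ℕ → A} → (∀ k → f k ≡ g k) → ∀ n → applyUpTo f n ≡ applyUpTo g n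
applyUpTo-cong f≗g zero    = refl
applyUpTo-cong f≗g (suc n) = cong₂ _∷_ (f≗g 0) (applyUpTo-cong (f≗g ∘ suc) n)

-- No column of a convolution is padding on both tracks, so `These` covers exactly the columns that
-- occur. The form `alignWith` replaces arithmetic on positions by induction on the words.
⊗≡alignWith : (u v : List A) → ⊗ (u ∷ v ∷ []) ≡ alignWith pair u v
⊗≡alignWith u v =
  trans (cong (λ l → applyUpTo (column u v) (length u ⊔ l)) (⊔-identityʳ (length v))) (columns u v)
  where
  column : List A → List A → ℕ → Vec (Maybe A) 2
  column u v k = head (drop k u) ∷ head (drop k v) ∷ []

  columns : ∀ u v → applyUpTo (column u v) (length u ⊔ length v) ≡ alignWith pair u v
  columns []      []      = refl
  columns []      (y ∷ v) = cong (_ ∷_)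
    -- `drop k []` computes only once `k` is split, here and in the next clause.
    (trans (applyUpTo-cong (λ { zero → refl ; (suc k) → refl }) (length v)) (columns [] v))
  columns (x ∷ u) []      = cong (_ ∷_) (trans
    (applyUpTo-cong (λ { zero → refl ; (suc k) → refl }) (length u))
    (trans (cong (applyUpTo (column u [])) (sym (⊔-identityʳ (length u))))
           (trans (columns u []) (alignWith-[] u))))
    where
    alignWith-[] : ∀ u → alignWith pair u [] ≡ map (pair ∘ this) u
    alignWith-[] []      = refl
    alignWith-[] (_ ∷ _) = refl
  columns (x ∷ u) (y ∷ v) = cong (_ ∷_) (columns u v)

mapMaybe-head-pair : (u v : List A) → mapMaybe Vec.head (alignWith pair u v) ≡ u
mapMaybe-head-pair []      []      = refl
mapMaybe-head-pair []      (y ∷ v) = mapMaybe-head-pair [] v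
mapMaybe-head-pair (x ∷ []) []      = refl
mapMaybe-head-pair (x ∷ u@(_ ∷ _)) []      = cong (x ∷_) (mapMaybe-head-pair u [])
mapMaybe-head-pair (x ∷ u) (y ∷ v) = cong (x ∷_) (mapMaybe-head-pair u v)

mapMaybe-last-pair : (u v : List A) → mapMaybe Vec.last (alignWith pair u v) ≡ v
mapMaybe-last-pair []      []      = refl
mapMaybe-last-pair []      (y ∷ v) = cong (y ∷_) (mapMaybe-last-pair [] v)
mapMaybe-last-pair (x ∷ []) []      = refl
mapMaybe-last-pair (x ∷ u@(_ ∷ _)) []      = mapMaybe-last-pair u []
mapMaybe-last-pair (x ∷ u) (y ∷ v) = cong (y ∷_) (mapMaybe-last-pair u v)

-- `mapMaybe` reads one track and drops its padding, which leaves the original word.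
alignWith-pair-injective : {u v u′ v′ : List A} →
  alignWith pair u v ≡ alignWith pair u′ v′ → u ≡ u′ × v ≡ v′
alignWith-pair-injective {u = u} {v} {u′} {v′} eq =
  trans (sym (mapMaybe-head-pair u v))
    (trans (cong (mapMaybe Vec.head) eq) (mapMaybe-head-pair u′ v′)) ,
  trans (sym (mapMaybe-last-pair u v))
    (trans (cong (mapMaybe Vec.last) eq) (mapMaybe-last-pair u′ v′))

-- Brings a long word on the first track into second position, so that `alignWith-split` serves both
-- orders of a pair.
alignWith-swap : (f : These A B → C) → ∀ u v → alignWith f u v ≡ alignWith (f ∘ swap) v u
alignWith-swap f []      []      = refl
alignWith-swap f []      (_ ∷ _) = refl
alignWith-swap f (_ ∷ _) []      = refl
alignWith-swap f (x ∷ u) (y ∷ v) = cong (_ ∷_) (alignWith-swap f u v)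

-- After `n` columns the word `u` has ended, so what follows depends on `v` alone.
alignWith-split : (f : These A B → C) → ∀ n u v → length u ℕ.≤ n →
  alignWith f u v ≡ alignWith f u (take n v) ++ map (f ∘ that) (drop n v)
alignWith-split f n       []      v       _         =
  trans (cong (map (f ∘ that)) (sym (take++drop≡id n v))) (map-++ (f ∘ that) (take n v) (drop n v))
alignWith-split f (suc n) (_ ∷ _) []      _         = sym (++-identityʳ _)
alignWith-split f (suc n) (_ ∷ u) (_ ∷ v) (s≤s u≤n) = cong (_ ∷_) (alignWith-split f n u v u≤n)

-- Prefixes, finite bounds and codes for subsets

take-+ : ∀ m n (v : List A) → take (m + n) v ≡ take m v ++ take n (drop m v)
take-+ zero    n v       = refl
take-+ (suc m) zero []      = refl
take-+ (suc m) (suc n) []   = refl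
take-+ (suc m) n (x ∷ v) = cong (x ∷_) (take-+ m n v)

length-take≤ : ∀ n (v : List A) → length (take n v) ℕ.≤ n
length-take≤ n v = ≤-trans (≤-reflexive (length-take n v)) (m⊓n≤m n (length v))

upperBound : ∀ {n} (f : Fin n → ℕ) → ∃[ b ] (∀ i → f i ℕ.≤ b)
upperBound {zero}  f = 0 , λ ()
upperBound {suc n} f with b , f≤b ← upperBound (f ∘ suc) =
  f zero ⊔ b , λ { zero    → m≤m⊔n (f zero) b
                 ; (suc i) → ≤-trans (f≤b i) (m≤n⊔m (f zero) b) }

lookup-injective : {xs : List A} → Unique xs → Injective _≡_ _≡_ (lookup xs)
lookup-injective (x∉ ∷ uniq) {zero}  {zero}  eq = refl
lookup-injective {xs = _ ∷ xs} (x∉ ∷ uniq) {zero}  {suc j} eq =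
  contradiction eq (All.lookup x∉ (∈-lookup {xs = xs} j))
lookup-injective {xs = _ ∷ xs} (x∉ ∷ uniq) {suc i} {zero}  eq =
  contradiction (sym eq) (All.lookup x∉ (∈-lookup {xs = xs} i))
lookup-injective (x∉ ∷ uniq) {suc i} {suc j} eq = cong suc (lookup-injective uniq eq)

-- The code is a number, so that sets of states can be counted and enter a signature.
indicator : ∀ {n} {P : Pred (Fin n) p} → Decidable P → Fin (2 ^ n)
indicator P? = funToFin (λ i → bit (does (P? i)))
  where
  bit : Bool → Fin 2
  bit false = zero
  bit true  = suc zero

indicator-⊆ : ∀ {n} {P : Pred (Fin n) p} {Q : Pred (Fin n) q}
  (P? : Decidable P) (Q? : Decidable Q) → indicator P? ≡ indicator Q? → ∀ {i} → P i → Q i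
indicator-⊆ P? Q? eq {i} Pi
  with P? i | Q? i
     -- The two `i`-th bits agree; where `P i` holds and `Q i` fails this reads `suc zero ≡ zero`.
     | trans (sym (finToFun-funToFin _ i))
         (trans (cong (λ k → finToFun k i) eq) (finToFun-funToFin _ i))
... | yes _  | yes Qi | _  = Qi
... | yes _  | no  _  | ()
... | no ¬Pi | _      | _  = contradiction Pi ¬Pi

-- Words of bounded length

words : ∀ k → ℕ → List (List (Fin k))
words k zero    = [] ∷ []
words k (suc n) = [] ∷ cartesianProductWith _∷_ (allFin k) (words k n)

∈-words : ∀ {k n} v → length v ℕ.≤ n → v ∈ words k n
∈-words {n = zero}  []      _         = here refl
∈-words {n = suc n} []      _         = here refl
∈-words {n = suc n} (x ∷ v) (s≤s v≤n) =
  there (∈-cartesianProductWith⁺ _∷_ (∈-allFin x) (∈-words v v≤n))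

∈-words⁻ : ∀ {k} n {v} → v ∈ words k n → length v ℕ.≤ n
∈-words⁻ zero    (here refl) = z≤n
∈-words⁻ (suc n) (here refl) = z≤n
∈-words⁻ {k} (suc n) (there v∈)
  with _ , _ , _ , u∈ , refl ← ∈-cartesianProductWith⁻ _∷_ (allFin k) (words k n) v∈ =
  s≤s (∈-words⁻ n u∈)

words-unique : ∀ k n → Unique (words k n)
words-unique k zero    = [] ∷ []
words-unique k (suc n) =
  All.tabulate (λ v∈ → λ { refl → []∉ v∈ })
  ∷ cartesianProductWith⁺ _∷_ ∷-injective (allFin⁺ k) (words-unique k n)
  where
  []∉ : ¬ ([] ∈ cartesianProductWith _∷_ (allFin k) (words k n))
  []∉ v∈ with _ , _ , _ , _ , () ← ∈-cartesianProductWith⁻ _∷_ (allFin k) (words k n) v∈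

-- Automata

module _ (M : DFA A) where
  open DFA M

  run : Fin states → List A → Fin states
  run = foldl step

  profile : List A → Fin (2 ^ states)
  profile v = indicator (λ s → run s v ∈? final)

  -- The word `u` only selects the state from which the suffix is read, and the profile records from
  -- which states the suffix is accepted.
  profile-++ : ∀ v v′ → profile v ≡ profile v′ → ∀ u → Accepts (u ++ v) → Accepts (u ++ v′)
  profile-++ v v′ eq u acc =
    subst (_∈ˢ final) (sym (foldl-++ step start u v′))
      (indicator-⊆ (λ s → run s v ∈? final) (λ s → run s v′ ∈? final) eq
        (subst (_∈ˢ final) (foldl-++ step start u v) acc))

  -- Once no word is accepted from s, any value of comp s will do, so that no pumping argument
  -- is needed.
  completions : ¬ ¬ (Σ[ comp ∈ (Fin states → List A) ]
                     (∀ s v → run s v ∈ˢ final → run s (comp s) ∈ˢ final))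
  completions = ¬¬-map (λ f → proj₁ ∘ f , proj₂ ∘ f) (Fin.sequence rawApplicative λ s none →
    none ([] , λ v acc → ⊥-elim (none (v , λ _ _ → acc))))
    where open RawMonad ¬¬-Monad using (rawApplicative)

module _ (f : These A B → C) (M : DFA C) where
  open DFA M

  -- By `alignWith-split` the input is a part fixed by `u` and `take n v`, followed by a part that
  -- matters only through its profile. The function `f` is arbitrary to allow both `pair` and
  -- `pair ∘ swap`.
  profile-alignWith : ∀ n v v′ → take n v ≡ take n v′ →
    profile M (map (f ∘ that) (drop n v)) ≡ profile M (map (f ∘ that) (drop n v′)) →
    ∀ u → length u ℕ.≤ n → Accepts (alignWith f u v) → Accepts (alignWith f u v′)
  profile-alignWith n v v′ take≡ profile≡ u u≤n acc =
    subst Accepts (sym (alignWith-split f n u v′ u≤n))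
      (subst (λ t → Accepts (alignWith f u t ++ map (f ∘ that) (drop n v′))) take≡
        (profile-++ M (map (f ∘ that) (drop n v)) (map (f ∘ that) (drop n v′)) profile≡
          (alignWith f u (take n v))
          (subst Accepts (alignWith-split f n u v u≤n) acc)))

-- The run on ⊗ (u , v) with length u ≤ n depends on v only through take n v and the
-- behaviour of M² on the rest of v.  To count the prefixes take n v, cut off their last c
-- letters and complete what remains to a word of length ≤ n in the domain; the cut-off part
-- and the state before it range over sets independent of m.
module Signature {k} (M : DFA (Fin k)) (M² : DFA (Vec (Maybe (Fin k)) 2))
  (comp : Fin (DFA.states M) → List (Fin k))
  (completes : ∀ s v → run M s v ∈ˢ DFA.final M → run M s (comp s) ∈ˢ DFA.final M)
  {c} (comp≤c : ∀ s → length (comp s) ℕ.≤ c)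
  where

  open DFA M using (states; start; step; final; Accepts)
  open DFA M² using () renaming (states to states²; Accepts to Accepts²)

  -- The factors count the state after `m` letters, the next at most `c` letters, and the profiles
  -- of the remainder read on the second and on the first track.
  bound : ℕ
  bound = states * (length (words k c) * (2 ^ states² * 2 ^ states²))

  module _ (m : ℕ) {N} (w : Fin N → List (Fin k))
    (covers : ∀ v → Accepts v → length v ℕ.≤ m + c → ∃[ i ] w i ≡ v)
    where

    n = m + c

    state : List (Fin k) → Fin states
    state v = run M start (take m v)

    completion : List (Fin k) → List (Fin k)
    completion v = take m v ++ comp (state v)

    -- The actual remainder `drop m v` shows that a final state is reachable from `state v`, so
    -- `comp` reaches one too.
    completion-accepted : ∀ v → Accepts v → Accepts (completion v)
    completion-accepted v acc = subst (_∈ˢ final) (sym (foldl-++ step start (take m v) _))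
      (completes (state v) (drop m v)
        (subst (_∈ˢ final) (foldl-++ step start (take m v) (drop m v))
          (subst Accepts (sym (take++drop≡id m v)) acc)))

    completion≤n : ∀ v → length (completion v) ℕ.≤ n
    completion≤n v = ≤-trans (≤-reflexive (length-++ (take m v)))
      (+-mono-≤ (length-take≤ m v) (comp≤c (state v)))

    representative : ∀ v → Accepts v → ∃[ i ] w i ≡ completion v
    representative v acc = covers (completion v) (completion-accepted v acc) (completion≤n v)

    middle : List (Fin k) → List (Fin k)
    middle v = take c (drop m v)

    middle∈words : ∀ v → middle v ∈ words k c
    middle∈words v = ∈-words (middle v) (length-take≤ c (drop m v))

    profileˡ profileʳ : List (Fin k) → Fin (2 ^ states²)
    profileˡ v = profile M² (map (pair ∘ that) (drop n v))
    profileʳ v = profile M² (map (pair ∘ swap ∘ that) (drop n v))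

    -- Only the index of the completion has a range that grows with `N`, which keeps the number of
    -- signatures linear in `N`.
    signature : ∀ v → Accepts v → Fin (N * bound)
    signature v acc = combine (proj₁ (representative v acc)) (combine (state v)
      (combine (index (middle∈words v)) (combine (profileˡ v) (profileʳ v))))

    record SameType (v v′ : List (Fin k)) : Set where
      field
        below : ∀ u → length u ℕ.≤ n → Accepts² (⊗ (u ∷ v ∷ [])) → Accepts² (⊗ (u ∷ v′ ∷ []))
        above : ∀ u → length u ℕ.≤ n → Accepts² (⊗ (v ∷ u ∷ [])) → Accepts² (⊗ (v′ ∷ u ∷ []))

    signature-determines-type : ∀ {v v′} acc acc′ →
      signature v acc ≡ signature v′ acc′ → SameType v v′
    signature-determines-type {v} {v′} acc acc′ eq
      with rep≡ , eq₁ ←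
             combine-injective (proj₁ (representative v acc)) _ (proj₁ (representative v′ acc′)) _ eq
      with state≡ , eq₂ ← combine-injective (state v) _ (state v′) _ eq₁
      with idx≡ , eq₃ ←
             combine-injective (index (middle∈words v)) _ (index (middle∈words v′)) _ eq₂
      with profileˡ≡ , profileʳ≡ ← combine-injective (profileˡ v) _ (profileˡ v′) _ eq₃ = record
      { below = λ u u≤n →
          subst Accepts² (sym (⊗≡alignWith u v′))
          ∘ profile-alignWith pair M² n v v′ take≡ profileˡ≡ u u≤n
          ∘ subst Accepts² (⊗≡alignWith u v)
      ; above = λ u u≤n →
          subst Accepts² (sym (trans (⊗≡alignWith v′ u) (alignWith-swap pair v′ u)))
          ∘ profile-alignWith (pair ∘ swap) M² n v v′ take≡ profileʳ≡ u u≤n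
          ∘ subst Accepts² (trans (⊗≡alignWith v u) (alignWith-swap pair v u))
      }
      where
      open ≡-Reasoning

      completion≡ : completion v ≡ completion v′
      completion≡ = trans (sym (proj₂ (representative v acc)))
        (trans (cong w rep≡) (proj₂ (representative v′ acc′)))

      prefix≡ : take m v ≡ take m v′
      -- Equal states have equal completing suffixes, so the suffix can be cancelled.
      prefix≡ = ++-cancelʳ (comp (state v)) (take m v) (take m v′)
        (trans completion≡ (cong (λ s → take m v′ ++ comp s) (sym state≡)))

      middle≡ : middle v ≡ middle v′
      middle≡ = begin
        middle v                                      ≡⟨ lookup-index (middle∈words v) ⟩
        lookup (words k c) (index (middle∈words v))   ≡⟨ cong (lookup (words k c)) idx≡ ⟩
        lookup (words k c) (index (middle∈words v′))  ≡⟨ lookup-index (middle∈words v′) ⟨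
        middle v′                                     ∎

      take≡ : take n v ≡ take n v′
      take≡ = begin
        take n v                  ≡⟨ take-+ m c v ⟩
        take m v ++ middle v      ≡⟨ cong₂ _++_ prefix≡ middle≡ ⟩
        take m v′ ++ middle v′    ≡⟨ take-+ m c v′ ⟨
        take n v′                 ∎

-- One-point extensions in the random partial order

-- These conditions let a new point above `Lower` and below `Upper` be added: the closure conditions
-- and `lower⊑upper` give transitivity, `disjoint` gives antisymmetry.
record Cut (P : FinitePoset) : Set₁ where
  open FinitePoset P using (size) renaming (_≤_ to _⊑_)
  field
    Lower Upper : Pred (Fin size) 0ℓ
    lower?      : Decidable Lower
    upper?      : Decidable Upper
    down-closed : ∀ {i j} → i ⊑ j → Lower j → Lower i
    up-closed   : ∀ {i j} → i ⊑ j → Upper i → Upper j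
    lower⊑upper : ∀ {i j} → Lower i → Upper j → i ⊑ j
    disjoint    : ∀ {i} → Lower i → ¬ Upper i

extend : (P : FinitePoset) → Cut P → FinitePoset
extend P cut = record
  { size              = suc size
  ; _≤_               = _⊑⁺_
  ; isDecPartialOrder = record
    { isPartialOrder = record
      { isPreorder = record
        { isEquivalence = isEquivalence
        ; reflexive     = λ { {zero} refl → tt ; {suc i} refl → refl′ }
        ; trans         = λ {i} {j} {k} → trans⁺ i j k
        }
      ; antisym = λ {i} {j} → antisym⁺ i j
      }
    ; _≟_  = Fin._≟_
    ; _≤?_ = dec⁺
    }
  }
  where
  open FinitePoset P using (size; isDecPartialOrder) renaming (_≤_ to _⊑_)
  open IsDecPartialOrder isDecPartialOrder
    using (_≤?_; antisym) renaming (refl to refl′; trans to trans′)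
  open Cut cut

  _⊑⁺_ : Rel (Fin (suc size)) 0ℓ
  zero  ⊑⁺ zero  = ⊤
  zero  ⊑⁺ suc j = Upper j
  suc i ⊑⁺ zero  = Lower i
  suc i ⊑⁺ suc j = i ⊑ j

  trans⁺ : ∀ i j k → i ⊑⁺ j → j ⊑⁺ k → i ⊑⁺ k
  trans⁺ zero    zero    k       _ q = q
  trans⁺ zero    (suc j) zero    _ _ = tt
  trans⁺ zero    (suc j) (suc k) p q = up-closed q p
  trans⁺ (suc i) zero    zero    p _ = p
  trans⁺ (suc i) zero    (suc k) p q = lower⊑upper p q
  trans⁺ (suc i) (suc j) zero    p q = down-closed p q
  trans⁺ (suc i) (suc j) (suc k) p q = trans′ p q

  antisym⁺ : ∀ i j → i ⊑⁺ j → j ⊑⁺ i → i ≡ j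
  antisym⁺ zero    zero    _ _ = refl
  antisym⁺ zero    (suc j) p q = contradiction p (disjoint q)
  antisym⁺ (suc i) zero    p q = contradiction q (disjoint p)
  antisym⁺ (suc i) (suc j) p q = cong suc (antisym p q)

  dec⁺ : ∀ i j → Dec (i ⊑⁺ j)
  dec⁺ zero    zero    = yes tt
  dec⁺ zero    (suc j) = upper? j
  dec⁺ (suc i) zero    = lower? i
  dec⁺ (suc i) (suc j) = i ≤? j

module RandomPartialOrder (U : Poset c ℓ₁ ℓ₂) (random : IsRandomPartialOrder U) where
  open Poset U hiding (refl; trans)
  open IsRandomPartialOrder random
  open IsOrderIsomorphism using (mono; cancel; surjective; injective)

  Embedding : (P : FinitePoset) → (Fin (FinitePoset.size P) → Carrier) → Set ℓ₂
  Embedding P x = ∀ i j → FinitePoset._≤_ P i j ⇔ x i ≤ x j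

  -- The family provided may contain repetitions and have another index set; composing with a
  -- section of the isomorphism indexes it by `P`.
  embed : ∀ P → ∃ (Embedding P)
  embed P with finitePosets-substructures P
  ... | n , x , f , f-iso = x ∘ proj₁ ∘ pre , λ i j →
    mk⇔ (λ i⊑j → cancel f-iso (subst₂ _⊑_ (sym (f∘pre i)) (sym (f∘pre j)) i⊑j))
        (λ xi≤xj → subst₂ _⊑_ (f∘pre i) (f∘pre j) (mono f-iso xi≤xj))
    where
    open FinitePoset P using () renaming (_≤_ to _⊑_)
    pre = surjective f-iso
    f∘pre : ∀ i → f (proj₁ (pre i)) ≡ i
    f∘pre i = proj₂ (pre i) Eq.refl

  -- By antisymmetry `≈` amounts to `≤` in both directions, so it is carried along with the order.
  sameOrder⇒≅ : ∀ {n} (x y : Fin n → Carrier) → (∀ i j → x i ≤ x j ⇔ y i ≤ y j) →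
    substructure U x ≅ substructure U y
  sameOrder⇒≅ x y same = id , record
    { isOrderMonomorphism = record
      { isOrderHomomorphism = record { cong = ≈⇒≈ ; mono = to (same _ _) }
      ; injective = λ e →
          antisym (from (same _ _) (reflexive e)) (from (same _ _) (reflexive (Eq.sym e)))
      ; cancel = from (same _ _)
      }
    ; surjective = λ i → i , ≈⇒≈
    }
    where
    ≈⇒≈ : ∀ {i j} → x i ≈ x j → y i ≈ y j
    ≈⇒≈ e = antisym (to (same _ _) (reflexive e)) (to (same _ _) (reflexive (Eq.sym e)))

  -- The extension property: embed `extend P cut` somewhere as `z`, let an automorphism `σ` move `x`
  -- onto the copy of `P` inside `z`, and pull the new point `z zero` back along `σ`.
  realise : ∀ P (cut : Cut P) (x : Fin (FinitePoset.size P) → Carrier) → Embedding P x →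
    ∃[ y ] (∀ i → Cut.Lower cut i ⇔ x i ≤ y) × (∀ i → Cut.Upper cut i ⇔ y ≤ x i)
  realise P cut x x-emb
    with z , z-emb ← embed (extend P cut)
    with (σ , σ-iso) , σx≈z ← ultrahomogeneous x (z ∘ suc)
           (sameOrder⇒≅ x (z ∘ suc) (λ i j → z-emb (suc i) (suc j) ⇔-∘ ⇔-sym (x-emb i j)))
    with y , σ≈ ← surjective σ-iso (z zero) =
    y , (λ i → below i ⇔-∘ z-emb (suc i) zero) , (λ i → above i ⇔-∘ z-emb zero (suc i))
    where
    σy≈ : σ y ≈ z zero
    σy≈ = σ≈ Eq.refl

    below : ∀ i → z (suc i) ≤ z zero ⇔ x i ≤ y
    below i = mk⇔
      (cancel σ-iso ∘ ≤-respˡ-≈ (Eq.sym (σx≈z i)) ∘ ≤-respʳ-≈ (Eq.sym σy≈))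
      (≤-respˡ-≈ (σx≈z i) ∘ ≤-respʳ-≈ σy≈ ∘ mono σ-iso)

    above : ∀ i → z zero ≤ z (suc i) ⇔ y ≤ x i
    above i = mk⇔
      (cancel σ-iso ∘ ≤-respˡ-≈ (Eq.sym σy≈) ∘ ≤-respʳ-≈ (Eq.sym (σx≈z i)))
      (≤-respˡ-≈ σy≈ ∘ ≤-respʳ-≈ (σx≈z i) ∘ mono σ-iso)

-- Recovering a pair from the type that it determines

module Separation (P : FinitePoset) where
  open FinitePoset P using (size; isDecPartialOrder) renaming (_≤_ to _⊑_)
  open IsDecPartialOrder isDecPartialOrder
    using (_≤?_; antisym) renaming (refl to ⊑-refl; trans to ⊑-trans)

  -- `L` and `V` stand for the sets of elements below and above some point. The two cases exclude
  -- each other, since `V` contains `j` in the first and is empty in the second.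
  data Pins (L V : Pred (Fin size) 0ℓ) (i j : Fin size) : Set where
    between   : L ≐ (_⊑ i) → V ≐ (j ⊑_) → Pins L V i j
    aboveBoth : ¬ i ⊑ j → ¬ j ⊑ i → L ≐ (λ l → l ⊑ i ⊎ l ⊑ j) → V ≐ ∅ → Pins L V i j

  -- In `separatingCut` the smaller element of a comparable pair comes first, whichever way the pair
  -- was given.
  PinsUnordered : (L V : Pred (Fin size) 0ℓ) (i j : Fin size) → Set
  PinsUnordered L V i j = Pins L V i j ⊎ Pins L V j i

  Pins-resp : ∀ {L V L′ V′ i j} → L′ ≐ L → V′ ≐ V → Pins L V i j → Pins L′ V′ i j
  Pins-resp L≐ V≐ (between L V)           = between (≐-trans L≐ L) (≐-trans V≐ V)
  Pins-resp L≐ V≐ (aboveBoth i⋢j j⋢i L V) = aboveBoth i⋢j j⋢i (≐-trans L≐ L) (≐-trans V≐ V)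

  SamePair : (i j i′ j′ : Fin size) → Set
  SamePair i j i′ j′ = (i ≡ i′ × j ≡ j′) ⊎ (i ≡ j′ × j ≡ i′)

  -- A principal set determines its generator by antisymmetry; in the incomparable case `i` and `j`
  -- are the maximal elements of `L`.
  Pins-unique : ∀ {L V i j i′ j′} → Pins L V i j → Pins L V i′ j′ → SamePair i j i′ j′
  Pins-unique (between L V) (between L′ V′) = inj₁
    ( antisym (proj₁ L′ (proj₂ L ⊑-refl)) (proj₁ L (proj₂ L′ ⊑-refl))
    , antisym (proj₁ V (proj₂ V′ ⊑-refl)) (proj₁ V′ (proj₂ V ⊑-refl)))
  Pins-unique (between L V) (aboveBoth _ _ L′ V′) = ⊥-elim (proj₁ V′ (proj₂ V ⊑-refl))
  Pins-unique (aboveBoth _ _ L V) (between L′ V′) = ⊥-elim (proj₁ V (proj₂ V′ ⊑-refl))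
  Pins-unique {i = i} {j} {i′} {j′} (aboveBoth i⋢j j⋢i L _) (aboveBoth i′⋢j′ j′⋢i′ L′ _)
    with proj₁ L′ (proj₂ L (inj₁ ⊑-refl)) | proj₁ L′ (proj₂ L (inj₂ ⊑-refl))
       | proj₁ L (proj₂ L′ (inj₁ ⊑-refl)) | proj₁ L (proj₂ L′ (inj₂ ⊑-refl))
  -- Each generator lies below one of the other pair. Unless these relations match the generators up
  -- mutually, two of them compose to a comparison between `i` and `j`.
  ... | inj₁ i⊑i′ | inj₁ j⊑i′ | inj₁ i′⊑i | _ = ⊥-elim (j⋢i (⊑-trans j⊑i′ i′⊑i))
  ... | inj₁ i⊑i′ | inj₁ j⊑i′ | inj₂ i′⊑j | _ = ⊥-elim (i⋢j (⊑-trans i⊑i′ i′⊑j))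
  ... | inj₂ i⊑j′ | inj₂ j⊑j′ | _ | inj₁ j′⊑i = ⊥-elim (j⋢i (⊑-trans j⊑j′ j′⊑i))
  ... | inj₂ i⊑j′ | inj₂ j⊑j′ | _ | inj₂ j′⊑j = ⊥-elim (i⋢j (⊑-trans i⊑j′ j′⊑j))
  ... | inj₁ i⊑i′ | inj₂ j⊑j′ | inj₂ i′⊑j | _ = ⊥-elim (i⋢j (⊑-trans i⊑i′ i′⊑j))
  ... | inj₁ i⊑i′ | inj₂ j⊑j′ | _ | inj₁ j′⊑i = ⊥-elim (j⋢i (⊑-trans j⊑j′ j′⊑i))
  ... | inj₁ i⊑i′ | inj₂ j⊑j′ | inj₁ i′⊑i | inj₂ j′⊑j = inj₁ (antisym i⊑i′ i′⊑i , antisym j⊑j′ j′⊑j)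
  ... | inj₂ i⊑j′ | inj₁ j⊑i′ | inj₁ i′⊑i | _ = ⊥-elim (j⋢i (⊑-trans j⊑i′ i′⊑i))
  ... | inj₂ i⊑j′ | inj₁ j⊑i′ | _ | inj₂ j′⊑j = ⊥-elim (i⋢j (⊑-trans i⊑j′ j′⊑j))
  ... | inj₂ i⊑j′ | inj₁ j⊑i′ | inj₂ i′⊑j | inj₁ j′⊑i = inj₂ (antisym i⊑j′ j′⊑i , antisym j⊑i′ i′⊑j)

  PinsUnordered-unique : ∀ {L V i j i′ j′} →
    PinsUnordered L V i j → PinsUnordered L V i′ j′ → SamePair i j i′ j′
  PinsUnordered-unique (inj₁ π) (inj₁ π′) = Pins-unique π π′
  PinsUnordered-unique (inj₁ π) (inj₂ π′) = Sum.swap (Pins-unique π π′)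
  PinsUnordered-unique (inj₂ π) (inj₁ π′) =
    Sum.map Product.swap Product.swap (Sum.swap (Pins-unique π π′))
  PinsUnordered-unique (inj₂ π) (inj₂ π′) = Sum.map Product.swap Product.swap (Pins-unique π π′)

  betweenCut : ∀ {i j} → i ⊑ j → i ≢ j → Cut P
  betweenCut {i} {j} i⊑j i≢j = record
    { Lower       = _⊑ i
    ; Upper       = j ⊑_
    ; lower?      = _≤? i
    ; upper?      = j ≤?_
    ; down-closed = ⊑-trans
    ; up-closed   = λ k⊑l j⊑k → ⊑-trans j⊑k k⊑l
    ; lower⊑upper = λ l⊑i j⊑u → ⊑-trans l⊑i (⊑-trans i⊑j j⊑u)
    ; disjoint    = λ l⊑i j⊑l → i≢j (antisym i⊑j (⊑-trans j⊑l l⊑i))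
    }

  aboveCut : ∀ i j → Cut P
  aboveCut i j = record
    { Lower       = λ l → l ⊑ i ⊎ l ⊑ j
    ; Upper       = ∅
    ; lower?      = λ l → l ≤? i ⊎-dec l ≤? j
    ; upper?      = λ _ → no λ ()
    ; down-closed = λ k⊑l → Sum.map (⊑-trans k⊑l) (⊑-trans k⊑l)
    ; up-closed   = λ _ ()
    ; lower⊑upper = λ _ ()
    ; disjoint    = λ _ ()
    }

  separatingCut : ∀ i j → i ≢ j →
    Σ[ cut ∈ Cut P ] PinsUnordered (Cut.Lower cut) (Cut.Upper cut) i j
  separatingCut i j i≢j with i ≤? j | j ≤? i
  ... | yes i⊑j | _       = betweenCut i⊑j i≢j , inj₁ (between ≐-refl ≐-refl)
  ... | no _    | yes j⊑i = betweenCut j⊑i (i≢j ∘ sym) , inj₂ (between ≐-refl ≐-refl)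
  ... | no i⋢j  | no j⋢i  = aboveCut i j , inj₁ (aboveBoth i⋢j j⋢i ≐-refl ≐-refl)

-- Counting

product-injective⇒≤ : ∀ {m n o} (f : Fin m → Fin n → Fin o) →
  (∀ i j i′ j′ → f i j ≡ f i′ j′ → i ≡ i′ × j ≡ j′) → m * n ℕ.≤ o
product-injective⇒≤ {m} {n} f inj = injective⇒≤ {f = uncurry f ∘ remQuot n} λ {x} {y} eq →
  let i≡ , j≡ = inj _ _ _ _ eq in
  trans (sym (combine-remQuot {m} n x)) (trans (cong₂ combine i≡ j≡) (combine-remQuot {m} n y))

↑ˡ≢↑ʳ : ∀ {m n} (i : Fin m) (j : Fin n) → i ↑ˡ n ≢ m ↑ʳ j
↑ˡ≢↑ʳ {m} {n} i j eq
  with () ← trans (sym (splitAt-↑ˡ m i n)) (trans (cong (splitAt m) eq) (splitAt-↑ʳ m n j))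

-- The ordered pairs (i, j) with i < b + 1 ≤ j already outnumber N * b.
pair-labelling-bound : ∀ {N b r} → suc b + suc (suc b * b + r) ≡ N →
  (f : (i j : Fin N) → i ≢ j → Fin (N * b)) →
  ¬ (∀ i j i≢j i′ j′ i′≢j′ → f i j i≢j ≡ f i′ j′ i′≢j′ → (i ≡ i′ × j ≡ j′) ⊎ (i ≡ j′ × j ≡ i′))
pair-labelling-bound {b = b} {r} refl f inj = ℕ.<-irrefl refl (begin-strict
  suc b * suc (suc b * b + r)                     ≤⟨ product-injective⇒≤ g g-injective ⟩
  (suc b + suc (suc b * b + r)) * b               <⟨ ℕ.m≤m+n _ r ⟩
  suc ((suc b + suc (suc b * b + r)) * b) + r     ≡⟨ solve 2 (λ b r →
      con 1 :+ (con 1 :+ b :+ (con 1 :+ ((con 1 :+ b) :* b :+ r))) :* b :+ r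
      := (con 1 :+ b) :* (con 1 :+ ((con 1 :+ b) :* b :+ r))) refl b r ⟩
  suc b * suc (suc b * b + r)                     ∎)
  where
  open ≤-Reasoning
  open +-*-Solver

  g : Fin (suc b) → Fin (suc (suc b * b + r)) → Fin _
  g i j = f (i ↑ˡ _) (suc b ↑ʳ j) (↑ˡ≢↑ʳ i j)

  g-injective : ∀ i j i′ j′ → g i j ≡ g i′ j′ → i ≡ i′ × j ≡ j′
  g-injective i j i′ j′ eq with inj _ _ _ _ _ _ eq
  ... | inj₁ (i≡ , j≡) = ↑ˡ-injective _ i i′ i≡ , ↑ʳ-injective (suc b) j j′ j≡
  ... | inj₂ (i≡ , _)  = contradiction i≡ (↑ˡ≢↑ʳ i j′)

-- Types over the short words of an automatic presentation

module _ {U : Poset c ℓ₁ ℓ₂} (random : IsRandomPartialOrder U)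
         (presentation : AutomaticPresentation (Poset.rawRelation U)) where
  open AutomaticPresentation presentation
  open RandomPartialOrder U random
  open IsOrderIsomorphism (proj₂ isomorphism) using (mono; cancel; injective; surjective)
  private module U = Poset U

  M : DFA (Fin k)
  M = proj₁ D-regular

  M² : DFA (Vec (Maybe (Fin k)) 2)
  M² = proj₁ R-recognisable

  D⇔ : ∀ v → D v ⇔ DFA.Accepts M v
  D⇔ = proj₂ D-regular

  -- Recognisability only yields some tuple in `R` with the given convolution; injectivity of the
  -- convolution identifies it with `u ∷ v ∷ []`.
  R⇔ : ∀ u v → R (u ∷ v ∷ []) ⇔ DFA.Accepts M² (⊗ (u ∷ v ∷ []))
  R⇔ u v = mk⇔ (λ r → to (R⇔′ _) (_ , r , refl)) (λ acc → recover (from (R⇔′ _) acc))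
    where
    R⇔′ = proj₂ R-recognisable
    recover : (∃[ ws ] (R ws × ⊗ (u ∷ v ∷ []) ≡ ⊗ ws)) → R (u ∷ v ∷ [])
    recover (u′ ∷ v′ ∷ [] , r , eq)
      with refl , refl ← alignWith-pair-injective {u = u} {v} {u′} {v′}
             (trans (sym (⊗≡alignWith u v)) (trans eq (⊗≡alignWith u′ v′))) = r

  value : ∃ D → U.Carrier
  value = proj₁ isomorphism

  preimage : U.Carrier → ∃ D
  preimage x = proj₁ (surjective x)

  value-preimage : ∀ x → value (preimage x) U.≈ x
  value-preimage x = proj₂ (surjective x) refl

  R⇔≤ : ∀ (u v : ∃ D) → R (proj₁ u ∷ proj₁ v ∷ []) ⇔ value u U.≤ value v
  R⇔≤ u v = mk⇔ (mono {u} {v}) (cancel {u} {v})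

  D? : Decidable D
  D? v = map′ (from (D⇔ v)) (to (D⇔ v)) (_ ∈? DFA.final M)

  chain : ℕ → FinitePoset
  chain n = record
    { size              = n
    ; _≤_               = Fin._≤_
    ; isDecPartialOrder = IsDecTotalOrder.isDecPartialOrder Fin.≤-isDecTotalOrder
    }

  module BoundedWords (n : ℕ) where

    domain : List (List (Fin k))
    domain = filter D? (words k n)

    N : ℕ
    N = length domain

    w : Fin N → List (Fin k)
    w = lookup domain

    w-injective : Injective _≡_ _≡_ w
    w-injective = lookup-injective (filter⁺ D? (words-unique k n))

    w-covers : ∀ {v} → D v → length v ℕ.≤ n → ∃[ i ] w i ≡ v
    w-covers {v} Dv v≤n = index v∈ , sym (lookup-index v∈)
      where v∈ = ∈-filter⁺ D? (∈-words v v≤n) Dv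

    w∈D : ∀ i → D (w i)
    w∈D i = proj₂ (∈-filter⁻ D? {xs = words k n} (∈-lookup {xs = domain} i))

    w≤n : ∀ i → length (w i) ℕ.≤ n
    w≤n i = ∈-words⁻ n (proj₁ (∈-filter⁻ D? {xs = words k n} (∈-lookup {xs = domain} i)))

    element : Fin N → ∃ D
    element i = w i , w∈D i

    -- The words are listed without repetition, which turns antisymmetry of `U` into equality of
    -- indices, and `M²` decides the order.
    P : FinitePoset
    P = record
      { size              = N
      ; _≤_               = λ i j → R (w i ∷ w j ∷ [])
      ; isDecPartialOrder = record
        { isPartialOrder = record
          { isPreorder = record
            { isEquivalence = isEquivalence
            ; reflexive     = λ { {i} refl → from (R⇔≤ (element i) (element i)) U.refl }
            ; trans         = λ {i} {j} {l} p q → from (R⇔≤ (element i) (element l))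
                (U.trans (to (R⇔≤ (element i) (element j)) p) (to (R⇔≤ (element j) (element l)) q))
            }
          ; antisym = λ {i} {j} p q → w-injective (injective {element i} {element j}
              (U.antisym (to (R⇔≤ (element i) (element j)) p) (to (R⇔≤ (element j) (element i)) q)))
          }
        ; _≟_  = Fin._≟_
        ; _≤?_ = λ i j → map′ (from (R⇔ (w i) (w j))) (to (R⇔ (w i) (w j))) (_ ∈? DFA.final M²)
        }
      }

    open Separation P public

    Below Above : List (Fin k) → Pred (Fin N) 0ℓ
    Below v i = R (w i ∷ v ∷ [])
    Above v i = R (v ∷ w i ∷ [])

    -- The cut is realised in `U`, and surjectivity of the presentation names the realising point by
    -- a word. Its length is not bounded, which is why signatures must account for letters beyond
    -- position `n`.
    pinningWord : ∀ i j → i ≢ j → ∃[ v ] (D v × PinsUnordered (Below v) (Above v) i j)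
    pinningWord i j i≢j
      with cut , pins ← separatingCut i j i≢j
      with y , below , above ← realise P cut (value ∘ element) (λ i j → R⇔≤ (element i) (element j)) =
      proj₁ v , proj₂ v , Sum.map (Pins-resp below≐ above≐) (Pins-resp below≐ above≐) pins
      where
      v = preimage y

      value-v : value v U.≈ y
      value-v = value-preimage y

      below≐ : Below (proj₁ v) ≐ Cut.Lower cut
      below≐ =
        (λ {i} → from (below i) ∘ U.≤-respʳ-≈ value-v ∘ to (R⇔≤ (element i) v)) ,
        (λ {i} → from (R⇔≤ (element i) v) ∘ U.≤-respʳ-≈ (U.Eq.sym value-v) ∘ to (below i))

      above≐ : Above (proj₁ v) ≐ Cut.Upper cut
      above≐ =
        (λ {i} → from (above i) ∘ U.≤-respˡ-≈ value-v ∘ to (R⇔≤ v (element i))) ,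
        (λ {i} → from (R⇔≤ v (element i)) ∘ U.≤-respˡ-≈ (U.Eq.sym value-v) ∘ to (above i))

  -- A chain of `K` elements embeds in `U`. Its elements have distinct words, and `m` bounds the
  -- lengths of these.
  domain-unbounded : ∀ K → ∃[ m ] (∀ n → m ℕ.≤ n → K ℕ.≤ BoundedWords.N n)
  domain-unbounded K with x , x-emb ← embed (chain K) = m , λ n m≤n →
    let open BoundedWords n
        covering = λ i → w-covers (proj₂ (v i)) (≤-trans (v≤m i) m≤n)
    in injective⇒≤ {f = proj₁ ∘ covering} λ {i} {j} eq → v-injective i j
         (trans (sym (proj₂ (covering i))) (trans (cong w eq) (proj₂ (covering j))))
    where
    v : Fin K → ∃ D
    v = preimage ∘ x
    v-bounded = upperBound (length ∘ proj₁ ∘ v)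
    m = proj₁ v-bounded
    v≤m = proj₂ v-bounded
    v-injective : ∀ i j → proj₁ (v i) ≡ proj₁ (v j) → i ≡ j
    v-injective i j eq = Fin.≤-antisym
      (from (x-emb i j) (U.reflexive xi≈xj))
      (from (x-emb j i) (U.reflexive (U.Eq.sym xi≈xj)))
      where
      xi≈xj : x i U.≈ x j
      xi≈xj = U.Eq.trans (U.Eq.sym (value-preimage (x i)))
                (U.Eq.trans (IsOrderIsomorphism.cong (proj₂ isomorphism) eq) (value-preimage (x j)))

  module Labelling
    (comp : Fin (DFA.states M) → List (Fin k))
    (completes : ∀ s v → run M s v ∈ˢ DFA.final M → run M s (comp s) ∈ˢ DFA.final M)
    {c} (comp≤c : ∀ s → length (comp s) ℕ.≤ c)
    (m : ℕ)
    where

    open BoundedWords (m + c)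
    open Signature M M² comp completes comp≤c

    covers : ∀ v → DFA.Accepts M v → length v ℕ.≤ m + c → ∃[ i ] w i ≡ v
    covers v acc = w-covers (from (D⇔ v) acc)

    SameType⇒⊆ : ∀ {v v′} → SameType m w covers v v′ → Below v ⊆ Below v′ × Above v ⊆ Above v′
    SameType⇒⊆ {v} {v′} same =
      (λ {i} → from (R⇔ (w i) v′) ∘ below (w i) (w≤n i) ∘ to (R⇔ (w i) v)) ,
      (λ {i} → from (R⇔ v′ (w i)) ∘ above (w i) (w≤n i) ∘ to (R⇔ v (w i)))
      where open SameType same

    word : ∀ i j → i ≢ j → List (Fin k)
    word i j i≢j = proj₁ (pinningWord i j i≢j)

    accepted : ∀ i j i≢j → DFA.Accepts M (word i j i≢j)
    accepted i j i≢j = to (D⇔ _) (proj₁ (proj₂ (pinningWord i j i≢j)))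

    label : ∀ i j → i ≢ j → Fin (N * bound)
    label i j i≢j = signature m w covers (word i j i≢j) (accepted i j i≢j)

    sameType-pins : ∀ {v v′ i j i′ j′} → SameType m w covers v v′ → SameType m w covers v′ v →
      PinsUnordered (Below v) (Above v) i j → PinsUnordered (Below v′) (Above v′) i′ j′ →
      SamePair i j i′ j′
    sameType-pins {v} {v′} same same⁻¹ pins pins′ =
      PinsUnordered-unique pins (Sum.map (Pins-resp below≐ above≐) (Pins-resp below≐ above≐) pins′)
      where
      below≐ : Below v ≐ Below v′
      below≐ = proj₁ (SameType⇒⊆ same) , proj₁ (SameType⇒⊆ same⁻¹)

      above≐ : Above v ≐ Above v′
      above≐ = proj₂ (SameType⇒⊆ same) , proj₂ (SameType⇒⊆ same⁻¹)

    label-injective : ∀ i j i≢j i′ j′ i′≢j′ →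
      label i j i≢j ≡ label i′ j′ i′≢j′ → SamePair i j i′ j′
    label-injective i j i≢j i′ j′ i′≢j′ eq = sameType-pins
      (signature-determines-type m w covers (accepted i j i≢j) (accepted i′ j′ i′≢j′) eq)
      -- `SameType` gives inclusions only, so the equation is used in both directions.
      (signature-determines-type m w covers (accepted i′ j′ i′≢j′) (accepted i j i≢j) (sym eq))
      (proj₂ (proj₂ (pinningWord i j i≢j)))
      (proj₂ (proj₂ (pinningWord i′ j′ i′≢j′)))

  not-automatic : ⊥
  -- The goal is `⊥`, so the doubly negated completions may be taken as given.
  not-automatic = completions M λ (comp , completes) →
    let c , comp≤c = upperBound (length ∘ comp)
        b          = Signature.bound M M² comp completes comp≤c
        -- Since `b` does not depend on `m`, the latter can be chosen afterwards. The threshold is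
        -- `(b + 1)² + 1`, because `(b + 1) * (N - b - 1)` exceeds `N * b` exactly when `N` exceeds
        -- `(b + 1)²`.
        m , large  = domain-unbounded (suc b + suc (suc b * b))
        r , N≡     = m≤n⇒∃[o]m+o≡n (large (m + c) (m≤m+n m c))
        open Labelling comp completes comp≤c m
    in pair-labelling-bound (trans (sym (ℕ.+-assoc (suc b) (suc (suc b * b)) r)) N≡)
         label label-injective

corollary4p8 : ∀ {c ℓ₁ ℓ₂ : Level} (U : Poset c ℓ₁ ℓ₂) →
    IsRandomPartialOrder U → ¬ AutomaticPresentation (Poset.rawRelation U)
corollary4p8 U random presentation = not-automatic random presentation
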